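{- Consider the instance with keys $1,\dots,6$ and weights $(w_1,\dots,w_6)=(0,2,2,0,1,1)$, and let $L_{i,j}$ denote a minimizer of $C_{i,l}+C_{l+1,j}$ over the restricted range $l\in\{i+1,\dots,j-2\}$. Then $L_{1,6}=4$ and $L_{2,6}=3$, and both minimizers are unique in their restricted ranges. Consequently the minimizer monotonicity property $L_{i,j-1}\le L_{i,j}\le L_{i+1,j}$ is false for 2WCSTs even when the boundary cut-points $l=i$ and $l=j-1$ are excluded.
   Context: For an instance with keys $1,2,\dots,n$ (usual order) and weights $w_k\ge 0$, a two-way comparison search tree (2WCST) for a nonempty set of keys is a rooted binary decision tree whose leaves are in bijection with these keys and in which each internal node is labelled either with an equal-to test $\langle =k\rangle$ ("is $q=k$?") or a less-than test $\langle <k\rangle$ ("is $q<k$?") for a key $k$, and has two children, one for "yes" and one for "no". It is required that for each key $q$ in the set, the search for $q$ starting at the root ends in the leaf labelled $q$. Its cost is $\sum_k w_k\cdot\mathrm{depth}(k)$ over the keys in the set, where $\mathrm{depth}(k)$ is the number of comparison nodes on the path from the root to leaf $k$. For $1\le i\le j\le n$, $C_{i,j}$ denotes the minimum cost of a 2WCST for the set of keys $\{i,i+1,\dots,j\}$ (so $C_{i,i}=0$). -}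

module Defs where

open import Data.Bool using (Bool; if_then_else_; _∧_)
open import Data.Fin as Fin using (Fin; toℕ)
open import Data.Fin.Subset using (Subset; _∈_)
open import Data.Fin.Subset.Properties using (_∈?_)
open import Data.List using (List; allFin; filter; map; sum)
open import Data.Nat using (ℕ; suc; _+_; _*_; _∸_; _≤_; _≤?_)
open import Data.Product using (Σ-syntax; ∃-syntax; _×_; _,_)
open import Data.Vec using ([]; _∷_; lookup; tabulate)
open import Relation.Binary.PropositionalEquality using (_≡_)
open import Relation.Nullary.Decidable using (does)

-- Keys are the elements of Fin n; the element k stands for the key number
-- suc (toℕ k), so that the keys are numbered 1, …, n.
keyNumber : ∀ {n} → Fin n → ℕ
keyNumber k = suc (toℕ k)

-- Nonnegative weights are restricted to natural numbers.  They occur in general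
-- only in a refuted universal claim, so refuting it for these is the stronger
-- assertion.
Weights : ℕ → Set
Weights n = Fin n → ℕ

data Test (n : ℕ) : Set where
  equalTo  : Fin n → Test n
  lessThan : Fin n → Test n

answer : ∀ {n} → Test n → Fin n → Bool
answer (equalTo k)  q = does (q Fin.≟ k)
answer (lessThan k) q = does (q Fin.<? k)

-- In node t y z, the subtree y is the "yes" child and z the "no" child.
data Tree (n : ℕ) : Set where
  leaf : Fin n → Tree n
  node : Test n → Tree n → Tree n → Tree n

-- Leaf positions, as paths from the root; distinct positions may carry the
-- same label.
data Leaf {n : ℕ} : Tree n → Set where
  here  : ∀ {k} → Leaf (leaf k)
  inYes : ∀ {t y z} → Leaf y → Leaf (node t y z)
  inNo  : ∀ {t y z} → Leaf z → Leaf (node t y z)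

label : ∀ {n} {T : Tree n} → Leaf T → Fin n
label (here {k}) = k
label (inYes p)  = label p
label (inNo p)   = label p

depth : ∀ {n} {T : Tree n} → Leaf T → ℕ
depth here      = 0
depth (inYes p) = suc (depth p)
depth (inNo p)  = suc (depth p)

search : ∀ {n} (T : Tree n) → Fin n → Leaf T
search (leaf k)     q = here
search (node t y z) q = if answer t q then inYes (search y q) else inNo (search z q)

-- The first three fields say that label is a bijection from the leaves of T
-- onto S.  Since T has a leaf, S is necessarily nonempty.
record Is2WCST {n : ℕ} (S : Subset n) (T : Tree n) : Set where
  field
    label-∈          : (p : Leaf T) → label p ∈ S
    label-injective  : (p q : Leaf T) → label p ≡ label q → p ≡ q
    label-surjective : (k : Fin n) → k ∈ S → ∃[ p ] label {T = T} p ≡ k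
    search-correct   : (q : Fin n) → q ∈ S → label (search T q) ≡ q

-- In a 2WCST for S, the leaf labelled k ∈ S is search T k.
cost : ∀ {n} → Weights n → Subset n → Tree n → ℕ
cost {n} w S T = sum (map (λ k → w k * depth (search T k)) (filter (_∈? S) (allFin n)))

-- c is the minimum cost of a 2WCST for S.
IsMinCost : ∀ {n} → Weights n → Subset n → ℕ → Set
IsMinCost {n} w S c =
  (Σ[ T ∈ Tree n ] Is2WCST S T × cost w S T ≡ c) ×
  ((T : Tree n) → Is2WCST S T → c ≤ cost w S T)

-- The set of keys numbered i, …, j.
interval : ∀ {n} → ℕ → ℕ → Subset n
interval i j = tabulate λ k → does (i ≤? keyNumber k) ∧ does (keyNumber k ≤? j)

-- C[ w ] i , j ≔ c  means  C_{i,j} = c.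
C[_]_,_≔_ : ∀ {n} → Weights n → ℕ → ℕ → ℕ → Set
C[ w ] i , j ≔ c = IsMinCost w (interval i j) c

-- c = C_{i,l} + C_{l+1,j}
SplitCost : ∀ {n} → Weights n → (i j l c : ℕ) → Set
SplitCost w i j l c =
  ∃[ a ] ∃[ b ] (C[ w ] i , l ≔ a) × (C[ w ] suc l , j ≔ b) × c ≡ a + b

-- l ∈ {i+1, …, j-2}
RestrictedCut : (i j l : ℕ) → Set
RestrictedCut i j l = i + 1 ≤ l × l + 2 ≤ j

IsMinimizer : ∀ {n} → Weights n → (i j l : ℕ) → Set
IsMinimizer w i j l =
  RestrictedCut i j l ×
  (∃[ c ] SplitCost w i j l c ×
          (∀ l′ c′ → RestrictedCut i j l′ → SplitCost w i j l′ c′ → c ≤ c′))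

IsUniqueMinimizer : ∀ {n} → Weights n → (i j l : ℕ) → Set
IsUniqueMinimizer w i j l =
  IsMinimizer w i j l × (∀ l′ → IsMinimizer w i j l′ → l′ ≡ l)

-- Minimizers need not be unique in general, so the property asks for some
-- choice L of minimizers that is monotone; its negation thus excludes every
-- choice.  The restricted range for (i , j) is nonempty iff i + 3 ≤ j, so all
-- three minimizers compared below are defined iff i + 4 ≤ j.
MinimizerMonotonicity : ∀ {n} → Weights n → Set
MinimizerMonotonicity {n} w =
  Σ[ L ∈ (ℕ → ℕ → ℕ) ]
    (∀ i j → 1 ≤ i → i + 3 ≤ j → j ≤ n → IsMinimizer w i j (L i j)) ×
    (∀ i j → 1 ≤ i → i + 4 ≤ j → j ≤ n →
       L i (j ∸ 1) ≤ L i j × L i j ≤ L (i + 1) j)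

exampleWeights : Weights 6
exampleWeights = lookup (0 ∷ 2 ∷ 2 ∷ 0 ∷ 1 ∷ 1 ∷ [])

{-# OPTIONS --safe #-}
-- Distinct keys end in distinct leaves, and a leaf at depth 1 forces all other
-- leaves below its sibling.  This already gives the Huffman lower bounds
--
--   C₁₂ ≥ 2, C₃₆ ≥ 7;   C₁₃ ≥ 6, C₄₆ ≥ 3;   C₁₄ ≥ 6, C₅₆ ≥ 2;
--   C₂₃ ≥ 4, C₄₆ ≥ 3;   C₂₄ ≥ 6, C₅₆ ≥ 2
--
-- (with sums 9, 9, 8 for the cuts of (1 , 6) and 7, 8 for those of (2 , 6)).
-- Explicit trees attain the bounds for the two winning cuts 4 and 3, and
-- monotonicity would require L₁₆ ≤ L₂₆, that is 4 ≤ 3.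
module Submission where

open import Data.Empty using (⊥-elim)
open import Data.Fin using (Fin; #_)
open import Data.Fin.Properties using (all?) renaming (_≟_ to _≟ᶠ_)
open import Data.Fin.Subset using (Subset; _∈_)
open import Data.Fin.Subset.Properties using (_∈?_)
open import Data.Nat using (ℕ; suc; _+_; _*_; _≤_; _<_; _≤?_; z≤n; s≤s; _≟_)
open import Data.Nat.Properties
  using (≤-refl; <⇒≤; <⇒≱; +-suc; +-mono-≤; +-monoˡ-≤; *-monoʳ-≤; m+n≤o⇒n≤o)
open import Data.Nat.Tactic.RingSolver using (solve-∀)
open import Data.Product using (_×_; _,_; proj₁; proj₂)
open import Function using (_∘_)
open import Relation.Binary.PropositionalEquality
  using (_≡_; _≢_; refl; sym; trans; cong; subst; subst₂; ≢-sym)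
open import Relation.Nullary using (¬_; Dec; yes; no; contradiction)
open import Relation.Nullary.Decidable using (True; False; toWitness; toWitnessFalse; from-yes; _→-dec_)
open import Defs

private
  variable
    n : ℕ
    T : Tree n

-- Depth bounds for distinct leaves

distinct⇒1≤depth : {p q : Leaf T} → p ≢ q → 1 ≤ depth p
distinct⇒1≤depth {p = here} {here} p≢q = ⊥-elim (p≢q refl)
distinct⇒1≤depth {p = inYes _} _ = s≤s z≤n
distinct⇒1≤depth {p = inNo _}  _ = s≤s z≤n

-- If `p` has depth 1, then `q` and `r` share the sibling subtree, so `q` has depth at least 2. If
-- `p` is deeper, depth 1 for `q` suffices.
depth-sum₃ : {p q r : Leaf T} → p ≢ q → p ≢ r → q ≢ r → 3 ≤ depth p + depth q
depth-sum₃ {p = here} {here} p≢q _ _ = ⊥-elim (p≢q refl)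
depth-sum₃ {p = inYes here} {inYes here} p≢q _ _ = ⊥-elim (p≢q refl)
depth-sum₃ {p = inYes here} {inNo _} {inYes here} _ p≢r _ = ⊥-elim (p≢r refl)
depth-sum₃ {p = inYes here} {inNo _} {inNo _} _ _ q≢r =
  s≤s (s≤s (distinct⇒1≤depth (q≢r ∘ cong inNo)))
depth-sum₃ {p = inNo here} {inNo here} p≢q _ _ = ⊥-elim (p≢q refl)
depth-sum₃ {p = inNo here} {inYes _} {inNo here} _ p≢r _ = ⊥-elim (p≢r refl)
depth-sum₃ {p = inNo here} {inYes _} {inYes _} _ _ q≢r =
  s≤s (s≤s (distinct⇒1≤depth (q≢r ∘ cong inYes)))
depth-sum₃ {p = inYes (inYes _)} p≢q _ _ = +-mono-≤ (s≤s (s≤s z≤n)) (distinct⇒1≤depth (≢-sym p≢q))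
depth-sum₃ {p = inYes (inNo _)}  p≢q _ _ = +-mono-≤ (s≤s (s≤s z≤n)) (distinct⇒1≤depth (≢-sym p≢q))
depth-sum₃ {p = inNo (inYes _)}  p≢q _ _ = +-mono-≤ (s≤s (s≤s z≤n)) (distinct⇒1≤depth (≢-sym p≢q))
depth-sum₃ {p = inNo (inNo _)}   p≢q _ _ = +-mono-≤ (s≤s (s≤s z≤n)) (distinct⇒1≤depth (≢-sym p≢q))

-- The right side is what `cost` computes to when two keys have weight `c` and all others weight 0;
-- the final `0` comes from the empty sum.
weighted-depth-sum₃ : ∀ c {p q r : Leaf T} → p ≢ q → p ≢ r → q ≢ r →
                      c * 3 ≤ c * depth p + (c * depth q + 0)
weighted-depth-sum₃ c {p} {q} p≢q p≢r q≢r =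
  subst (c * 3 ≤_) (distrib c (depth p) (depth q)) (*-monoʳ-≤ c (depth-sum₃ p≢q p≢r q≢r))
  where
  distrib : ∀ c x y → c * (x + y) ≡ c * x + (c * y + 0)
  distrib = solve-∀

-- If `p` has depth 1, the other three leaves lie below its sibling, and `depth-sum₃` plus the two
-- edges above `q` and `r` gives 2 + 5. Otherwise `p` contributes at least 4, and `depth-sum₃` gives
-- the remaining 3.
depth-sum₄ : {p q r s : Leaf T} → p ≢ q → p ≢ r → p ≢ s → q ≢ r → q ≢ s → r ≢ s →
             7 ≤ 2 * depth p + (depth q + depth r)
depth-sum₄ {p = here} {here} p≢q _ _ _ _ _ = ⊥-elim (p≢q refl)
depth-sum₄ {p = inYes here} {inYes here} p≢q _ _ _ _ _ = ⊥-elim (p≢q refl)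
depth-sum₄ {p = inYes here} {inNo _} {inYes here} _ p≢r _ _ _ _ = ⊥-elim (p≢r refl)
depth-sum₄ {p = inYes here} {inNo _} {inNo _} {inYes here} _ _ p≢s _ _ _ = ⊥-elim (p≢s refl)
depth-sum₄ {p = inYes here} {inNo q} {inNo r} {inNo _} _ _ _ q≢r q≢s r≢s =
  -- The three `s≤s` remove the contribution 2 of `p` and the edge above `q`; `+-suc` exposes the
  -- edge above `r`.
  s≤s (s≤s (s≤s (subst (4 ≤_) (sym (+-suc (depth q) (depth r)))
    (s≤s (depth-sum₃ (q≢r ∘ cong inNo) (q≢s ∘ cong inNo) (r≢s ∘ cong inNo))))))
depth-sum₄ {p = inNo here} {inNo here} p≢q _ _ _ _ _ = ⊥-elim (p≢q refl)
depth-sum₄ {p = inNo here} {inYes _} {inNo here} _ p≢r _ _ _ _ = ⊥-elim (p≢r refl)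
depth-sum₄ {p = inNo here} {inYes _} {inYes _} {inNo here} _ _ p≢s _ _ _ = ⊥-elim (p≢s refl)
depth-sum₄ {p = inNo here} {inYes q} {inYes r} {inYes _} _ _ _ q≢r q≢s r≢s =
  s≤s (s≤s (s≤s (subst (4 ≤_) (sym (+-suc (depth q) (depth r)))
    (s≤s (depth-sum₃ (q≢r ∘ cong inYes) (q≢s ∘ cong inYes) (r≢s ∘ cong inYes))))))
depth-sum₄ {p = inYes (inYes p)} _ _ _ q≢r q≢s r≢s =
  +-mono-≤ (*-monoʳ-≤ 2 {2} {2 + depth p} (s≤s (s≤s z≤n))) (depth-sum₃ q≢r q≢s r≢s)
depth-sum₄ {p = inYes (inNo p)} _ _ _ q≢r q≢s r≢s =
  +-mono-≤ (*-monoʳ-≤ 2 {2} {2 + depth p} (s≤s (s≤s z≤n))) (depth-sum₃ q≢r q≢s r≢s)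
depth-sum₄ {p = inNo (inYes p)} _ _ _ q≢r q≢s r≢s =
  +-mono-≤ (*-monoʳ-≤ 2 {2} {2 + depth p} (s≤s (s≤s z≤n))) (depth-sum₃ q≢r q≢s r≢s)
depth-sum₄ {p = inNo (inNo p)} _ _ _ q≢r q≢s r≢s =
  +-mono-≤ (*-monoʳ-≤ 2 {2} {2 + depth p} (s≤s (s≤s z≤n))) (depth-sum₃ q≢r q≢s r≢s)

-- Search trees, split costs and unique minimizers

search-distinct : ∀ {S : Subset n} → Is2WCST S T → ∀ {j k} → j ∈ S → k ∈ S → j ≢ k →
                  search T j ≢ search T k
search-distinct V {j} {k} j∈S k∈S j≢k eq =
  j≢k (trans (sym (search-correct j j∈S)) (trans (cong label eq) (search-correct k k∈S)))
  where open Is2WCST V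

LowerBound : Weights n → (i j m : ℕ) → Set
LowerBound {n} w i j m = (T : Tree n) → Is2WCST (interval i j) T → m ≤ cost w (interval i j) T

-- `SplitCost` itself supplies optimal trees for both halves, so lower bounds alone dispose of a
-- losing cut, without its exact cost.
splitCost-≥ : ∀ (w : Weights n) i j l {a b c} → LowerBound w i l a → LowerBound w (suc l) j b →
              SplitCost w i j l c → a + b ≤ c
splitCost-≥ _ _ _ _ lb lb′ (_ , _ , ((T , V , refl) , _) , ((T′ , V′ , refl) , _) , refl) =
  +-mono-≤ (lb T V) (lb′ T′ V′)

-- Minimum cost is a relation rather than a function, so two values at the same cut have to be
-- compared: the minimality in the first bounds the second.
splitCost-minimal : ∀ (w : Weights n) i j l {c c′} → SplitCost w i j l c → SplitCost w i j l c′ →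
                    c ≤ c′
splitCost-minimal w i j l (_ , _ , (_ , lb) , (_ , lb′) , refl) = splitCost-≥ w i j l lb lb′

strictMinimizer : ∀ (w : Weights n) i j l {c} → RestrictedCut i j l → SplitCost w i j l c →
                  (∀ l′ c′ → l′ ≢ l → RestrictedCut i j l′ → SplitCost w i j l′ c′ → c < c′) →
                  IsUniqueMinimizer w i j l
strictMinimizer w i j l {c} r sp strict = (r , c , sp , minimal) , unique
  where
  minimal : ∀ l′ c′ → RestrictedCut i j l′ → SplitCost w i j l′ c′ → c ≤ c′
  minimal l′ c′ r′ sp′ with l′ ≟ l
  ... | yes refl = splitCost-minimal w i j l sp sp′
  ... | no l′≢l  = <⇒≤ (strict l′ c′ l′≢l r′ sp′)

  unique : ∀ l′ → IsMinimizer w i j l′ → l′ ≡ l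
  unique l′ (r′ , c′ , sp′ , min′) with l′ ≟ l
  ... | yes eq  = eq
  ... | no l′≢l = ⊥-elim (<⇒≱ (strict l′ c′ l′≢l r′ sp′) (min′ l c r sp))

-- Once `search T` inverts `label` on leaves, injectivity is automatic, and correct searches provide
-- surjectivity. For an explicit tree both hypotheses are finite checks.
search-inverse⇒Is2WCST : {S : Subset n} →
  (∀ p → label {T = T} p ∈ S × search T (label p) ≡ p) →
  (∀ q → q ∈ S → label (search T q) ≡ q) → Is2WCST S T
search-inverse⇒Is2WCST {T = T} inv correct = record
  { label-∈          = proj₁ ∘ inv
  ; label-injective  = λ p q eq → trans (sym (proj₂ (inv p))) (trans (cong (search T) eq) (proj₂ (inv q)))
  ; label-surjective = λ k k∈S → search T k , correct k k∈S
  ; search-correct   = correct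
  }

-- Lower bounds for interval costs

module Separation (i j : ℕ) {T : Tree 6} (V : Is2WCST (interval i j) T) where

  -- For concrete endpoints and keys the implicit `True` and `False` arguments evaluate to the unit
  -- type and are inferred.
  separate : (k l : Fin 6) {k∈ : True (k ∈? interval i j)} {l∈ : True (l ∈? interval i j)}
             {k≢l : False (k ≟ᶠ l)} → search T k ≢ search T l
  separate _ _ {k∈} {l∈} {k≢l} = search-distinct V (toWitness k∈) (toWitness l∈) (toWitnessFalse k≢l)

-- The key # k has number k + 1.
lowerBound₁₂ : LowerBound exampleWeights 1 2 2
lowerBound₁₂ T V = +-monoˡ-≤ 0 (*-monoʳ-≤ 2 (distinct⇒1≤depth (separate (# 1) (# 0))))
  where open Separation 1 2 V

lowerBound₅₆ : LowerBound exampleWeights 5 6 2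
lowerBound₅₆ T V = +-mono-≤ (*-monoʳ-≤ 1 (distinct⇒1≤depth (separate (# 4) (# 5))))
  (+-monoˡ-≤ 0 (*-monoʳ-≤ 1 (distinct⇒1≤depth (separate (# 5) (# 4)))))
  where open Separation 5 6 V

lowerBound₂₃ : LowerBound exampleWeights 2 3 4
lowerBound₂₃ T V = +-mono-≤ (*-monoʳ-≤ 2 (distinct⇒1≤depth (separate (# 1) (# 2))))
  (+-monoˡ-≤ 0 (*-monoʳ-≤ 2 (distinct⇒1≤depth (separate (# 2) (# 1)))))
  where open Separation 2 3 V

lowerBound₁₃ : LowerBound exampleWeights 1 3 6
lowerBound₁₃ T V = weighted-depth-sum₃ 2
  (separate (# 1) (# 2)) (separate (# 1) (# 0)) (separate (# 2) (# 0))
  where open Separation 1 3 V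

lowerBound₁₄ : LowerBound exampleWeights 1 4 6
lowerBound₁₄ T V = weighted-depth-sum₃ 2
  (separate (# 1) (# 2)) (separate (# 1) (# 0)) (separate (# 2) (# 0))
  where open Separation 1 4 V

lowerBound₂₄ : LowerBound exampleWeights 2 4 6
lowerBound₂₄ T V = weighted-depth-sum₃ 2
  (separate (# 1) (# 2)) (separate (# 1) (# 3)) (separate (# 2) (# 3))
  where open Separation 2 4 V

lowerBound₄₆ : LowerBound exampleWeights 4 6 3
lowerBound₄₆ T V = weighted-depth-sum₃ 1
  (separate (# 4) (# 5)) (separate (# 4) (# 3)) (separate (# 5) (# 3))
  where open Separation 4 6 V

lowerBound₃₆ : LowerBound exampleWeights 3 6 7
-- Key 3, of weight 2, plays `p`; keys 5 and 6 play `q` and `r`; key 4, of weight 0, is the fourth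
-- leaf.
lowerBound₃₆ T V = subst (7 ≤_) (rearrange (d (# 2)) (d (# 4)) (d (# 5))) (depth-sum₄
  (separate (# 2) (# 4)) (separate (# 2) (# 5))
  (separate (# 2) (# 3)) (separate (# 4) (# 5))
  (separate (# 4) (# 3)) (separate (# 5) (# 3)))
  where
  open Separation 3 6 V

  d : Fin 6 → ℕ
  d k = depth (search T k)

  rearrange : ∀ x y z → 2 * x + (y + z) ≡ 2 * x + (1 * y + (1 * z + 0))
  rearrange = solve-∀

-- Optimal trees for the winning cuts

correct? : ∀ (S : Subset n) (T : Tree n) → Dec (∀ q → q ∈ S → label (search T q) ≡ q)
correct? S T = all? λ q → (q ∈? S) →-dec (label (search T q) ≟ᶠ q)

minCost₁₄ : C[ exampleWeights ] 1 , 4 ≔ 6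
minCost₁₄ = (T₁₄ , search-inverse⇒Is2WCST inv (from-yes (correct? (interval 1 4) T₁₄)) , refl) , lowerBound₁₄
  where
  T₁₄ : Tree 6
  -- Equality tests put the heavy keys 2 and 3 at depths 1 and 2, costing 2 + 4; keys 1 and 4 lie at
  -- depth 3 for free.
  T₁₄ = node (equalTo (# 1)) (leaf (# 1))
       (node (equalTo (# 2)) (leaf (# 2))
       (node (lessThan (# 1)) (leaf (# 0)) (leaf (# 3))))

  inv : ∀ p → label {T = T₁₄} p ∈ interval 1 4 × search T₁₄ (label p) ≡ p
  inv (inYes here)               = from-yes (# 1 ∈? interval {6} 1 4) , refl
  inv (inNo (inYes here))        = from-yes (# 2 ∈? interval {6} 1 4) , refl
  inv (inNo (inNo (inYes here))) = from-yes (# 0 ∈? interval {6} 1 4) , refl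
  inv (inNo (inNo (inNo here)))  = from-yes (# 3 ∈? interval {6} 1 4) , refl

minCost₅₆ : C[ exampleWeights ] 5 , 6 ≔ 2
minCost₅₆ = (T₅₆ , search-inverse⇒Is2WCST inv (from-yes (correct? (interval 5 6) T₅₆)) , refl) , lowerBound₅₆
  where
  T₅₆ : Tree 6
  T₅₆ = node (equalTo (# 4)) (leaf (# 4)) (leaf (# 5))

  inv : ∀ p → label {T = T₅₆} p ∈ interval 5 6 × search T₅₆ (label p) ≡ p
  inv (inYes here) = from-yes (# 4 ∈? interval {6} 5 6) , refl
  inv (inNo here)  = from-yes (# 5 ∈? interval {6} 5 6) , refl

minCost₂₃ : C[ exampleWeights ] 2 , 3 ≔ 4
minCost₂₃ = (T₂₃ , search-inverse⇒Is2WCST inv (from-yes (correct? (interval 2 3) T₂₃)) , refl) , lowerBound₂₃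
  where
  T₂₃ : Tree 6
  T₂₃ = node (equalTo (# 1)) (leaf (# 1)) (leaf (# 2))

  inv : ∀ p → label {T = T₂₃} p ∈ interval 2 3 × search T₂₃ (label p) ≡ p
  inv (inYes here) = from-yes (# 1 ∈? interval {6} 2 3) , refl
  inv (inNo here)  = from-yes (# 2 ∈? interval {6} 2 3) , refl

minCost₄₆ : C[ exampleWeights ] 4 , 6 ≔ 3
minCost₄₆ = (T₄₆ , search-inverse⇒Is2WCST inv (from-yes (correct? (interval 4 6) T₄₆)) , refl) , lowerBound₄₆
  where
  T₄₆ : Tree 6
  T₄₆ = node (equalTo (# 4)) (leaf (# 4)) (node (equalTo (# 5)) (leaf (# 5)) (leaf (# 3)))

  inv : ∀ p → label {T = T₄₆} p ∈ interval 4 6 × search T₄₆ (label p) ≡ p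
  inv (inYes here)        = from-yes (# 4 ∈? interval {6} 4 6) , refl
  inv (inNo (inYes here)) = from-yes (# 5 ∈? interval {6} 4 6) , refl
  inv (inNo (inNo here))  = from-yes (# 3 ∈? interval {6} 4 6) , refl

-- The two minimizers and the failure of monotonicity

uniqueMinimizer₁₆ : IsUniqueMinimizer exampleWeights 1 6 4
uniqueMinimizer₁₆ = strictMinimizer exampleWeights 1 6 4 (from-yes (2 ≤? 4) , from-yes (6 ≤? 6))
  (6 , 2 , minCost₁₄ , minCost₅₆ , refl) strict
  where
  strict : ∀ l c → l ≢ 4 → RestrictedCut 1 6 l → SplitCost exampleWeights 1 6 l c → 8 < c
  strict 1 _ _ (s≤s () , _)
  -- `8 < c` unfolds to `9 ≤ c`, and 9 is 2 + 7 here and 6 + 3 for the next cut.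
  strict 2 _ _ _ = splitCost-≥ exampleWeights 1 6 2 lowerBound₁₂ lowerBound₃₆
  strict 3 _ _ _ = splitCost-≥ exampleWeights 1 6 3 lowerBound₁₃ lowerBound₄₆
  strict 4 _ l≢4 = ⊥-elim (l≢4 refl)
  -- For the cut `5 + l` the upper end of the range reduces to `l + 2 ≤ 1`, hence to `2 ≤ 1`.
  strict (suc (suc (suc (suc (suc l))))) _ _ (_ , s≤s (s≤s (s≤s (s≤s (s≤s l+2≤1))))) =
    contradiction (m+n≤o⇒n≤o l l+2≤1) λ { (s≤s ()) }

uniqueMinimizer₂₆ : IsUniqueMinimizer exampleWeights 2 6 3
uniqueMinimizer₂₆ = strictMinimizer exampleWeights 2 6 3 (from-yes (3 ≤? 3) , from-yes (5 ≤? 6))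
  (4 , 3 , minCost₂₃ , minCost₄₆ , refl) strict
  where
  strict : ∀ l c → l ≢ 3 → RestrictedCut 2 6 l → SplitCost exampleWeights 2 6 l c → 7 < c
  strict 1 _ _ (s≤s () , _)
  strict 2 _ _ (s≤s (s≤s ()) , _)
  strict 3 _ l≢3 = ⊥-elim (l≢3 refl)
  -- The only competing cut costs at least 6 + 2, against 4 + 3.
  strict 4 _ _ _ = splitCost-≥ exampleWeights 2 6 4 lowerBound₂₄ lowerBound₅₆
  strict (suc (suc (suc (suc (suc l))))) _ _ (_ , s≤s (s≤s (s≤s (s≤s (s≤s l+2≤1))))) =
    contradiction (m+n≤o⇒n≤o l l+2≤1) λ { (s≤s ()) }

mainTheorem8 : IsUniqueMinimizer exampleWeights 1 6 4 ×
    IsUniqueMinimizer exampleWeights 2 6 3 ×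
    ¬ ((n : ℕ) (w : Weights n) → MinimizerMonotonicity w)
mainTheorem8 = uniqueMinimizer₁₆ , uniqueMinimizer₂₆ , notMonotone
  where
  notMonotone : ¬ ((n : ℕ) (w : Weights n) → MinimizerMonotonicity w)
  notMonotone mono with mono 6 exampleWeights
  ... | L , isMin , monotone = <⇒≱ {3} {4} ≤-refl (subst₂ _≤_ L₁₆≡4 L₂₆≡3
      (proj₂ (monotone 1 6 (from-yes (1 ≤? 1)) (from-yes (5 ≤? 6)) ≤-refl)))
    where
    -- Uniqueness forces the values of any choice `L` at both pairs.
    L₁₆≡4 : L 1 6 ≡ 4
    L₁₆≡4 = proj₂ uniqueMinimizer₁₆ _ (isMin 1 6 (from-yes (1 ≤? 1)) (from-yes (4 ≤? 6)) ≤-refl)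

    L₂₆≡3 : L 2 6 ≡ 3
    L₂₆≡3 = proj₂ uniqueMinimizer₂₆ _ (isMin 2 6 (from-yes (1 ≤? 2)) (from-yes (5 ≤? 6)) ≤-refl)
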